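{- Let $\lambda$ be a nonzero real number, $x$ real, and $n\ge0$ an integer. Then $$\sum_{k=0}^{n}S_{1,\lambda}(n,k)\,\mathcal{E}_{k,\lambda}(x)=n!\sum_{k=0}^{n}\binom{x}{k}\Big(-\frac{1}{2}\Big)^{n-k},$$ and $$\mathcal{E}_{n,\lambda}(x)=\sum_{k=0}^{n}k!\,S_{2,\lambda}(n,k)\sum_{j=0}^{k}\binom{x}{j}\Big(-\frac{1}{2}\Big)^{k-j}.$$
   Context: For real $x$ and integer $k\ge0$: $(x)_{0,\lambda}=1$, $(x)_{k,\lambda}=x(x-\lambda)\cdots(x-(k-1)\lambda)$; $(x)_0=1$, $(x)_k=x(x-1)\cdots(x-k+1)$. The degenerate exponential is $e_\lambda^x(t)=\sum_{k\ge0}(x)_{k,\lambda}t^k/k!=(1+\lambda t)^{x/\lambda}$, and $e_\lambda(t)=e^1_\lambda(t)$. The degenerate Euler polynomials are defined by $\frac{2}{e_\lambda(t)+1}e_\lambda^x(t)=\sum_{n\ge0}\mathcal{E}_{n,\lambda}(x)\frac{t^n}{n!}$. The degenerate Stirling numbers are defined by $(x)_{n}=\sum_{k=0}^{n}S_{1,\lambda}(n,k)(x)_{k,\lambda}$ and $(x)_{n,\lambda}=\sum_{k=0}^{n}S_{2,\lambda}(n,k)(x)_{k}$ ($n\ge0$). -}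

module Defs where

open import Algebra.Bundles using (CommutativeRing; Semiring)
import Algebra.Definitions.RawSemiring as RawSemiringDefs
import Algebra.Properties.Semiring.Sum as SemiringSum
open import Data.Fin.Base using (toℕ)
open import Data.Fin.Properties using (toℕ≤pred[n])
open import Data.Integer.Base using (+_)
open import Data.Nat.Base as ℕ using (ℕ; zero; suc; _∸_; _⊔_; _!; s≤s)
import Data.Nat.Properties as ℕ
open import Data.Product.Base using (∃; _×_; _,_; proj₁; proj₂)
open import Data.Rational.Base as ℚ using (ℚ; 0ℚ; 1ℚ; ½; ∣_∣)
import Data.Rational.Properties as ℚ
open import Data.Rational.Solver using (module +-*-Solver)
open import Level using (0ℓ)
open import Relation.Binary.PropositionalEquality as ≡ using (_≡_; cong; subst)
open import Relation.Nullary.Negation using (¬_)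

-- The real numbers: Cauchy sequences of rationals, where equality of reals
-- is the relation "the difference tends to 0".

Close : ℚ → ℚ → ℚ → Set
Close ε p q = ∣ p ℚ.- q ∣ ℚ.< ε

record ℝ : Set where
  no-eta-equality
  constructor mkℝ
  field
    seq    : ℕ → ℚ
    cauchy : ∀ ε → 0ℚ ℚ.< ε → ∃ λ N → ∀ {m n} → N ℕ.≤ m → N ℕ.≤ n → Close ε (seq m) (seq n)

open ℝ public

infix 4 _≈_ _≉_

record _≈_ (x y : ℝ) : Set where
  no-eta-equality
  constructor mk≈
  field
    tends : ∀ ε → 0ℚ ℚ.< ε → ∃ λ N → ∀ {n} → N ℕ.≤ n → Close ε (seq x n) (seq y n)

open _≈_ public

_≉_ : ℝ → ℝ → Set
x ≉ y = ¬ (x ≈ y)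

private
  module QS = +-*-Solver
  open QS using (_:=_; _:+_; _:*_; _:-_; :-_; con)

  abstract
    half>0 : ∀ {ε} → 0ℚ ℚ.< ε → 0ℚ ℚ.< ½ ℚ.* ε
    half>0 {ε} 0<ε = subst (ℚ._< ½ ℚ.* ε) (ℚ.*-zeroʳ ½) (ℚ.*-monoʳ-<-pos ½ 0<ε)

    halves : ∀ ε → ½ ℚ.* ε ℚ.+ ½ ℚ.* ε ≡ ε
    halves = QS.solve 1 (λ e → con ½ :* e :+ con ½ :* e := e) ≡.refl

    close-refl : ∀ {ε} p → 0ℚ ℚ.< ε → Close ε p p
    close-refl {ε} p 0<ε = subst (λ z → ∣ z ∣ ℚ.< ε) (≡.sym (ℚ.+-inverseʳ p)) 0<ε

    close-sym : ∀ {ε} p q → Close ε p q → Close ε q p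
    close-sym {ε} p q = subst (ℚ._< ε) (≡.trans (≡.sym (ℚ.∣-p∣≡∣p∣ (p ℚ.- q)))
      (cong ∣_∣ (QS.solve 2 (λ a b → :- (a :- b) := b :- a) ≡.refl p q)))

    close-split : ∀ {ε} r s t → r ≡ s ℚ.+ t → ∣ s ∣ ℚ.< ½ ℚ.* ε → ∣ t ∣ ℚ.< ½ ℚ.* ε → ∣ r ∣ ℚ.< ε
    close-split {ε} _ s t ≡.refl s< t< = ℚ.≤-<-trans (ℚ.∣p+q∣≤∣p∣+∣q∣ s t)
      (subst (∣ s ∣ ℚ.+ ∣ t ∣ ℚ.<_) (halves ε) (ℚ.+-mono-< s< t<))

    close-trans : ∀ {ε} p q r → Close (½ ℚ.* ε) p q → Close (½ ℚ.* ε) q r → Close ε p r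
    close-trans p q r = close-split _ _ _
      (QS.solve 3 (λ a b c → a :- c := (a :- b) :+ (b :- c)) ≡.refl p q r)

    close-+ : ∀ {ε} a b c d → Close (½ ℚ.* ε) a c → Close (½ ℚ.* ε) b d → Close ε (a ℚ.+ b) (c ℚ.+ d)
    close-+ a b c d = close-split _ _ _
      (QS.solve 4 (λ a b c d → (a :+ b) :- (c :+ d) := (a :- c) :+ (b :- d)) ≡.refl a b c d)

    close-neg : ∀ {ε} a b → Close ε a b → Close ε (ℚ.- a) (ℚ.- b)
    close-neg {ε} a b = subst (ℚ._< ε) (≡.trans (≡.sym (ℚ.∣-p∣≡∣p∣ (a ℚ.- b)))
      (cong ∣_∣ (QS.solve 2 (λ a b → :- (a :- b) := (:- a) :- (:- b)) ≡.refl a b)))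

    -- The accuracy needed of factors bounded by B for a product accurate to ε.
    prodTol : ∀ B ε → 0ℚ ℚ.< B → 0ℚ ℚ.< ε → ∃ λ δ → 0ℚ ℚ.< δ × B ℚ.* δ ≡ ½ ℚ.* ε
    prodTol B ε 0<B 0<ε = δ , 0<δ , eq
      where
      instance
        B+ : ℚ.Positive B
        B+ = ℚ.positive 0<B
        B≠0 : ℚ.NonZero B
        B≠0 = ℚ.pos⇒nonZero B
        1/B+ : ℚ.Positive (ℚ.1/ B)
        1/B+ = ℚ.1/pos⇒pos B
      δ : ℚ
      δ = ℚ.1/ B ℚ.* (½ ℚ.* ε)
      0<δ : 0ℚ ℚ.< δ
      0<δ = subst (ℚ._< δ) (ℚ.*-zeroʳ (ℚ.1/ B)) (ℚ.*-monoʳ-<-pos (ℚ.1/ B) (half>0 0<ε))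
      eq : B ℚ.* δ ≡ ½ ℚ.* ε
      eq = ≡.trans (≡.sym (ℚ.*-assoc B (ℚ.1/ B) (½ ℚ.* ε)))
        (≡.trans (cong (ℚ._* (½ ℚ.* ε)) (ℚ.*-inverseʳ B)) (ℚ.*-identityˡ (½ ℚ.* ε)))

    bound-* : ∀ B {η} δ u v → 0ℚ ℚ.< B → B ℚ.* δ ≡ η → ∣ u ∣ ℚ.≤ B → ∣ v ∣ ℚ.< δ → ∣ u ℚ.* v ∣ ℚ.< η
    bound-* B δ u v 0<B ≡.refl u≤ v< = subst (ℚ._< B ℚ.* δ) (≡.sym (ℚ.∣p*q∣≡∣p∣*∣q∣ u v))
      (ℚ.≤-<-trans (ℚ.*-monoʳ-≤-nonNeg ∣ v ∣ u≤) (ℚ.*-monoʳ-<-pos B v<))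
      where
      instance
        B+ : ℚ.Positive B
        B+ = ℚ.positive 0<B
        v≥0 : ℚ.NonNegative ∣ v ∣
        v≥0 = ℚ.∣-∣-nonNeg v

    close-* : ∀ B {ε} δ a b c d → 0ℚ ℚ.< B → B ℚ.* δ ≡ ½ ℚ.* ε → ∣ a ∣ ℚ.≤ B → ∣ d ∣ ℚ.≤ B →
              Close δ a c → Close δ b d → Close ε (a ℚ.* b) (c ℚ.* d)
    close-* B δ a b c d 0<B eq a≤ d≤ ac bd = close-split _ _ _
      (QS.solve 4 (λ a b c d → (a :* b) :- (c :* d) := (a :* (b :- d)) :+ (d :* (a :- c))) ≡.refl a b c d)
      (bound-* B δ a (b ℚ.- d) 0<B eq a≤ bd)
      (bound-* B δ d (a ℚ.- c) 0<B eq d≤ ac)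

    p≤p+q : ∀ p {q} → 0ℚ ℚ.≤ q → p ℚ.≤ p ℚ.+ q
    p≤p+q p {q} 0≤q = subst (ℚ._≤ p ℚ.+ q) (ℚ.+-identityʳ p) (ℚ.+-monoʳ-≤ p 0≤q)

    sum>0 : ∀ {p q} → 0ℚ ℚ.< p → 0ℚ ℚ.≤ q → 0ℚ ℚ.< p ℚ.+ q
    sum>0 {p} 0<p 0≤q = ℚ.<-≤-trans 0<p (p≤p+q p 0≤q)

    bounded : ∀ x → ∃ λ B → 0ℚ ℚ.< B × ∃ λ N → ∀ {n} → N ℕ.≤ n → ∣ seq x n ∣ ℚ.≤ B
    bounded x with cauchy x 1ℚ (ℚ.positive⁻¹ 1ℚ)
    ... | N , close = 1ℚ ℚ.+ ∣ seq x N ∣ , sum>0 {1ℚ} (ℚ.positive⁻¹ 1ℚ) (ℚ.0≤∣p∣ (seq x N)) , N , λ {n} N≤n →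
      ℚ.≤-trans
        (subst (λ z → ∣ z ∣ ℚ.≤ ∣ seq x n ℚ.- seq x N ∣ ℚ.+ ∣ seq x N ∣)
          (QS.solve 2 (λ a b → (a :- b) :+ b := a) ≡.refl (seq x n) (seq x N))
          (ℚ.∣p+q∣≤∣p∣+∣q∣ (seq x n ℚ.- seq x N) (seq x N)))
        (ℚ.+-monoˡ-≤ ∣ seq x N ∣ (ℚ.<⇒≤ (close N≤n ℕ.≤-refl)))

  bounded₂ : ∀ x y → ∃ λ B → 0ℚ ℚ.< B × ∃ λ N → ∀ {n} → N ℕ.≤ n → ∣ seq x n ∣ ℚ.≤ B × ∣ seq y n ∣ ℚ.≤ B
  bounded₂ x y = combine (bounded x) (bounded y)
    where
    Bound : ℝ → Set
    Bound z = ∃ λ B → 0ℚ ℚ.< B × ∃ λ N → ∀ {n} → N ℕ.≤ n → ∣ seq z n ∣ ℚ.≤ B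
    combine : Bound x → Bound y → ∃ λ B → 0ℚ ℚ.< B × ∃ λ N → ∀ {n} → N ℕ.≤ n → ∣ seq x n ∣ ℚ.≤ B × ∣ seq y n ∣ ℚ.≤ B
    combine (B , 0<B , M , x≤) (C , 0<C , N , y≤) =
      B ℚ.+ C , sum>0 {B} {C} 0<B (ℚ.<⇒≤ 0<C) , M ⊔ N , λ p →
      ℚ.≤-trans (x≤ (ℕ.≤-trans (ℕ.m≤m⊔n M N) p)) (p≤p+q B {C} (ℚ.<⇒≤ 0<C)) ,
      ℚ.≤-trans (y≤ (ℕ.≤-trans (ℕ.m≤n⊔m M N) p)) (subst (C ℚ.≤_) (ℚ.+-comm C B) (p≤p+q C {B} (ℚ.<⇒≤ 0<B)))

  ⊔ˡ : ∀ {m n o} → m ⊔ n ℕ.≤ o → m ℕ.≤ o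
  ⊔ˡ {m} {n} = ℕ.≤-trans (ℕ.m≤m⊔n m n)

  ⊔ʳ : ∀ {m n o} → m ⊔ n ℕ.≤ o → n ℕ.≤ o
  ⊔ʳ {m} {n} = ℕ.≤-trans (ℕ.m≤n⊔m m n)

infixl 6 _+_ _-_
infixl 7 _*_
infix  8 -_

ι : ℚ → ℝ
seq    (ι q) _       = q
cauchy (ι q) ε 0<ε = 0 , λ _ _ → close-refl q 0<ε

0ℝ 1ℝ : ℝ
0ℝ = ι 0ℚ
1ℝ = ι 1ℚ

_+_ : ℝ → ℝ → ℝ
seq    (x + y) n = seq x n ℚ.+ seq y n
cauchy (x + y) ε 0<ε with cauchy x _ (half>0 0<ε) | cauchy y _ (half>0 0<ε)
... | M , xc | N , yc = M ⊔ N , λ {m} {n} p q →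
  close-+ (seq x m) (seq y m) (seq x n) (seq y n) (xc (⊔ˡ {M} p) (⊔ˡ {M} q)) (yc (⊔ʳ {M} p) (⊔ʳ {M} q))

-_ : ℝ → ℝ
seq    (- x) n = ℚ.- seq x n
cauchy (- x) ε 0<ε with cauchy x ε 0<ε
... | N , xc = N , λ {m} {n} p q → close-neg (seq x m) (seq x n) (xc p q)

_*_ : ℝ → ℝ → ℝ
seq    (x * y) n = seq x n ℚ.* seq y n
cauchy (x * y) ε 0<ε with bounded₂ x y
... | B , 0<B , K , xy≤ with prodTol B ε 0<B 0<ε
... | δ , 0<δ , eq with cauchy x δ 0<δ | cauchy y δ 0<δ
... | M , xc | N , yc = K ⊔ (M ⊔ N) , λ {m} {n} p q →
  close-* B δ (seq x m) (seq y m) (seq x n) (seq y n) 0<B eq (proj₁ (xy≤ (⊔ˡ {K} p))) (proj₂ (xy≤ (⊔ˡ {K} q)))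
    (xc (⊔ˡ {M} (⊔ʳ {K} p)) (⊔ˡ {M} (⊔ʳ {K} q))) (yc (⊔ʳ {M} (⊔ʳ {K} p)) (⊔ʳ {M} (⊔ʳ {K} q)))

_-_ : ℝ → ℝ → ℝ
x - y = x + (- y)

pointwise : ∀ {x y} → (∀ n → seq x n ≡ seq y n) → x ≈ y
tends (pointwise {x} {y} eq) ε 0<ε =
  0 , λ {n} _ → subst (Close ε (seq x n)) (eq n) (close-refl (seq x n) 0<ε)

≈-refl : ∀ {x} → x ≈ x
≈-refl = pointwise (λ _ → ≡.refl)

≈-sym : ∀ {x y} → x ≈ y → y ≈ x
tends (≈-sym {x} {y} p) ε 0<ε with tends p ε 0<ε
... | N , c = N , λ {n} q → close-sym (seq x n) (seq y n) (c q)

≈-trans : ∀ {x y z} → x ≈ y → y ≈ z → x ≈ z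
tends (≈-trans {x} {y} {z} p q) ε 0<ε with tends p _ (half>0 0<ε) | tends q _ (half>0 0<ε)
... | M , c | N , d = M ⊔ N , λ {n} r → close-trans (seq x n) (seq y n) (seq z n) (c (⊔ˡ {M} r)) (d (⊔ʳ {M} r))

+-cong : ∀ {x y u v} → x ≈ y → u ≈ v → x + u ≈ y + v
tends (+-cong {x} {y} {u} {v} p q) ε 0<ε with tends p _ (half>0 0<ε) | tends q _ (half>0 0<ε)
... | M , c | N , d = M ⊔ N , λ {n} r → close-+ (seq x n) (seq u n) (seq y n) (seq v n) (c (⊔ˡ {M} r)) (d (⊔ʳ {M} r))

neg-cong : ∀ {x y} → x ≈ y → - x ≈ - y
tends (neg-cong {x} {y} p) ε 0<ε with tends p ε 0<ε
... | N , c = N , λ {n} q → close-neg (seq x n) (seq y n) (c q)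

*-cong : ∀ {x y u v} → x ≈ y → u ≈ v → x * u ≈ y * v
tends (*-cong {x} {y} {u} {v} p q) ε 0<ε with bounded₂ x v
... | B , 0<B , K , xv≤ with prodTol B ε 0<B 0<ε
... | δ , 0<δ , eq with tends p δ 0<δ | tends q δ 0<δ
... | M , c | N , d = K ⊔ (M ⊔ N) , λ {n} r →
  close-* B δ (seq x n) (seq u n) (seq y n) (seq v n) 0<B eq (proj₁ (xv≤ (⊔ˡ {K} r))) (proj₂ (xv≤ (⊔ˡ {K} r)))
    (c (⊔ˡ {M} (⊔ʳ {K} r))) (d (⊔ʳ {M} (⊔ʳ {K} r)))

ℝ-commutativeRing : CommutativeRing 0ℓ 0ℓ
ℝ-commutativeRing = record
  { Carrier = ℝ ; _≈_ = _≈_ ; _+_ = _+_ ; _*_ = _*_ ; -_ = -_ ; 0# = 0ℝ ; 1# = 1ℝ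
  ; isCommutativeRing = record
    { isRing = record
      { +-isAbelianGroup = record
        { isGroup = record
          { isMonoid = record
            { isSemigroup = record
              { isMagma = record
                { isEquivalence = record { refl = ≈-refl ; sym = ≈-sym ; trans = ≈-trans }
                ; ∙-cong = +-cong
                }
              ; assoc = λ x y z → pointwise λ n → ℚ.+-assoc (seq x n) (seq y n) (seq z n)
              }
            ; identity = (λ x → pointwise λ n → ℚ.+-identityˡ (seq x n))
                       , (λ x → pointwise λ n → ℚ.+-identityʳ (seq x n))
            }
          ; inverse = (λ x → pointwise λ n → ℚ.+-inverseˡ (seq x n))
                    , (λ x → pointwise λ n → ℚ.+-inverseʳ (seq x n))
          ; ⁻¹-cong = neg-cong
          }
        ; comm = λ x y → pointwise λ n → ℚ.+-comm (seq x n) (seq y n)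
        }
      ; *-cong = *-cong
      ; *-assoc = λ x y z → pointwise λ n → ℚ.*-assoc (seq x n) (seq y n) (seq z n)
      ; *-identity = (λ x → pointwise λ n → ℚ.*-identityˡ (seq x n))
                   , (λ x → pointwise λ n → ℚ.*-identityʳ (seq x n))
      ; distrib = (λ x y z → pointwise λ n → ℚ.*-distribˡ-+ (seq x n) (seq y n) (seq z n))
                , (λ x y z → pointwise λ n → ℚ.*-distribʳ-+ (seq x n) (seq y n) (seq z n))
      }
    ; *-comm = λ x y → pointwise λ n → ℚ.*-comm (seq x n) (seq y n)
    }
  }

open RawSemiringDefs (Semiring.rawSemiring (CommutativeRing.semiring ℝ-commutativeRing)) public using (_^_; sum)

fromℕᵣ : ℕ → ℝ
fromℕᵣ n = ι (+ n ℚ./ 1)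

1/_! : ℕ → ℝ
1/ k ! = ι ((+ 1 ℚ./ (k !)) {{k ℕ.!≢0}})

-- Σ[ k ≤ n ] f k  is the sum of f 0, …, f n.
Σ≤ : ℕ → (ℕ → ℝ) → ℝ
Σ≤ n f = sum {suc n} (λ i → f (toℕ i))

syntax Σ≤ n (λ k → t) = Σ[ k ≤ n ] t
infixr 5 Σ≤

-- ff[ lam ] x k  is  (x)_{k,λ} = x (x − λ) ⋯ (x − (k−1)λ).
ff[_] : ℝ → ℝ → ℕ → ℝ
ff[ lam ] x zero    = 1ℝ
ff[ lam ] x (suc k) = ff[ lam ] x k * (x - fromℕᵣ k * lam)

-- ff x k  is  (x)_k = x (x − 1) ⋯ (x − k + 1).
ff : ℝ → ℕ → ℝ
ff x zero    = 1ℝ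
ff x (suc k) = ff x k * (x - fromℕᵣ k)

binom : ℝ → ℕ → ℝ
binom x k = ff x k * 1/ k !

-- Formal power series in t, given by the coefficient of each tⁿ.
Series : Set
Series = ℕ → ℝ

constS : ℝ → Series
constS c zero    = c
constS c (suc _) = 0ℝ

infixl 6 _⊕_
infixl 7 _⊛_

_⊕_ : Series → Series → Series
(f ⊕ g) n = f n + g n

_⊛_ : Series → Series → Series
(f ⊛ g) n = Σ[ k ≤ n ] f k * g (n ∸ k)

-- The reciprocal g of a series f whose constant term has inverse c:
--   g₀ = c,  g₍ₙ₊₁₎ = − c Σ_{i≤n} f₍ᵢ₊₁₎ g₍ₙ₋ᵢ₎.
-- recipRev f c n i  is  g₍ₙ₋ᵢ₎ for i ≤ n.
recipRev : Series → ℝ → ℕ → ℕ → ℝ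
recipRev f c zero    _       = c
recipRev f c (suc n) zero    = - (c * (Σ[ i ≤ n ] f (suc i) * recipRev f c n i))
recipRev f c (suc n) (suc i) = recipRev f c n i

recip : Series → ℝ → Series
recip f c n = recipRev f c n 0

private
  module Sum = SemiringSum (CommutativeRing.semiring ℝ-commutativeRing)

  recipRev-recip : ∀ f c n {i} → i ℕ.≤ n → recipRev f c n i ≡ recip f c (n ∸ i)
  recipRev-recip f c n       {zero}  _         = ≡.refl
  recipRev-recip f c (suc n) {suc i} (s≤s i≤n) = recipRev-recip f c n i≤n

recip-inverse : ∀ f c → f 0 * c ≈ 1ℝ → ∀ n → (f ⊛ recip f c) n ≈ constS 1ℝ n
recip-inverse f c f₀c≈1 zero    = ≈-trans (CommutativeRing.+-identityʳ ℝ-commutativeRing _) f₀c≈1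
recip-inverse f c f₀c≈1 (suc n) =
  ≈-trans (+-cong ≈-refl (≈-sym (Sum.sum-cong-≋ {suc n} λ i → *-cong (≈-refl {f (suc (toℕ i))}) (≡⇒≈ (recipRev-recip f c n (toℕ≤pred[n] i))))))
  (≈-trans (pointwise λ m → QS.solve 3 (λ a b t → a :* (:- (b :* t)) :+ t := (con 1ℚ :- a :* b) :* t) ≡.refl
             (seq (f 0) m) (seq c m) (seq T m))
  (≈-trans (*-cong (+-cong (≈-refl {1ℝ}) (neg-cong f₀c≈1)) (≈-refl {T}))
  (pointwise λ m → QS.solve 1 (λ t → (con 1ℚ :- con 1ℚ) :* t := con 0ℚ) ≡.refl (seq T m))))
  where
  T : ℝ
  T = Σ[ i ≤ n ] f (suc i) * recipRev f c n i
  ≡⇒≈ : ∀ {x y} → x ≡ y → x ≈ y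
  ≡⇒≈ ≡.refl = ≈-refl

-- e_λ^x(t)
dexp : ℝ → ℝ → Series
dexp lam x k = ff[ lam ] x k * 1/ k !

-- e_λ(t) + 1, with constant term 2
dexp+1 : ℝ → Series
dexp+1 lam = dexp lam 1ℝ ⊕ constS 1ℝ

dexp+1-recip : ∀ lam n → (dexp+1 lam ⊛ recip (dexp+1 lam) (ι ½)) n ≈ constS 1ℝ n
dexp+1-recip lam = recip-inverse (dexp+1 lam) (ι ½) (pointwise λ _ → ≡.refl)

-- 2 / (e_λ(t) + 1)
eulerSeries : ℝ → Series
eulerSeries lam = constS (fromℕᵣ 2) ⊛ recip (dexp+1 lam) (ι ½)

-- 𝓔 lam n x  is  𝓔_{n,λ}(x), that is n! times the coefficient of tⁿ in
-- 2 / (e_λ(t) + 1) · e_λ^x(t).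
𝓔 : ℝ → ℕ → ℝ → ℝ
𝓔 lam n x = fromℕᵣ (n !) * (eulerSeries lam ⊛ dexp lam x) n

-- Only the values S n k with k ≤ n are constrained.
IsStirling₁ : ℝ → (ℕ → ℕ → ℝ) → Set
IsStirling₁ lam S = ∀ n x → ff x n ≈ Σ[ k ≤ n ] S n k * ff[ lam ] x k

IsStirling₂ : ℝ → (ℕ → ℕ → ℝ) → Set
IsStirling₂ lam S = ∀ n x → ff[ lam ] x n ≈ Σ[ k ≤ n ] S n k * ff x k

-- Existence.  If pₖ₊₁ = pₖ (x − aₖ) and qₙ₊₁ = qₙ (x − bₙ) then
-- qₙ = Σ_{k≤n} S(n,k) pₖ with S(n+1,k) = S(n,k−1) + (aₖ − bₙ) S(n,k).
private
  connection : (a b : ℕ → ℝ) → ℕ → ℕ → ℝ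
  connection a b zero    zero    = 1ℝ
  connection a b zero    (suc k) = 0ℝ
  connection a b (suc n) zero    = (a 0 - b n) * connection a b n 0
  connection a b (suc n) (suc k) = connection a b n k + (a (suc k) - b n) * connection a b n (suc k)

  connection-zero : ∀ a b {n k} → n ℕ.< k → connection a b n k ≈ 0ℝ
  connection-zero a b {zero}  {suc k} _         = ≈-refl
  connection-zero a b {suc n} {suc k} (s≤s n<k) = ≈-trans
    (+-cong (connection-zero a b n<k) (*-cong (≈-refl {a (suc k) - b n}) (connection-zero a b (ℕ.m≤n⇒m≤1+n n<k))))
    (pointwise λ m → QS.solve 1 (λ u → con 0ℚ :+ u :* con 0ℚ := con 0ℚ) ≡.refl (seq (a (suc k) - b n) m))

  Σ-last : ∀ n f → Σ≤ (suc n) f ≈ Σ≤ n f + f (suc n)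
  Σ-last zero    f = pointwise λ m → QS.solve 2 (λ u v → u :+ (v :+ con 0ℚ) := (u :+ con 0ℚ) :+ v) ≡.refl (seq (f 0) m) (seq (f 1) m)
  Σ-last (suc n) f = ≈-trans (+-cong (≈-refl {f 0}) (Σ-last n (λ k → f (suc k))))
    (≈-sym (CommutativeRing.+-assoc ℝ-commutativeRing _ _ _))

  Σ-cong : ∀ n {f g : ℕ → ℝ} → (∀ k → f k ≈ g k) → Σ≤ n f ≈ Σ≤ n g
  Σ-cong n f≈g = Sum.sum-cong-≋ {suc n} (λ i → f≈g (toℕ i))

  connection-spec : ∀ a b x (p q : ℕ → ℝ) → p 0 ≈ 1ℝ → q 0 ≈ 1ℝ →
    (∀ k → p (suc k) ≈ p k * (x - a k)) → (∀ n → q (suc n) ≈ q n * (x - b n)) →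
    ∀ n → q n ≈ Σ[ k ≤ n ] connection a b n k * p k
  connection-spec a b x p q p₀ q₀ p₊ q₊ zero = ≈-trans q₀ (≈-trans (≈-sym p₀)
    (pointwise λ m → QS.solve 1 (λ u → u := con 1ℚ :* u :+ con 0ℚ) ≡.refl (seq (p 0) m)))
  connection-spec a b x p q p₀ q₀ p₊ q₊ (suc n) =
    ≈-trans (q₊ n)
    (≈-trans (*-cong (connection-spec a b x p q p₀ q₀ p₊ q₊ n) (≈-refl {x - b n}))
    (≈-trans (Sum.*-distribʳ-sum {suc n} (x - b n) (λ i → C (toℕ i) * p (toℕ i)))
    (≈-trans (Σ-cong n step)
    (≈-trans (Sum.∑-distrib-+ {suc n} (λ i → C (toℕ i) * p (suc (toℕ i))) (λ i → D (toℕ i) * p (toℕ i)))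
    (≈-trans (+-cong (≈-refl {A}) top)
    (≈-trans (pointwise λ m → QS.solve 3 (λ u v w → u :+ (v :+ w) := v :+ (u :+ w)) ≡.refl (seq A m) (seq (D 0 * p 0) m) (seq B m))
    (+-cong (≈-refl {D 0 * p 0})
      (≈-trans (≈-sym (Sum.∑-distrib-+ {suc n} (λ i → C (toℕ i) * p (suc (toℕ i))) (λ i → D (suc (toℕ i)) * p (suc (toℕ i)))))
        (Σ-cong n λ k → ≈-sym (CommutativeRing.distribʳ ℝ-commutativeRing (p (suc k)) (C k) (D (suc k))))))))))))
    where
    C D : ℕ → ℝ
    C = connection a b n
    D k = (a k - b n) * C k
    A B : ℝ
    A = Σ[ k ≤ n ] C k * p (suc k)
    B = Σ[ k ≤ n ] D (suc k) * p (suc k)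
    step : ∀ k → C k * p k * (x - b n) ≈ C k * p (suc k) + D k * p k
    step k = ≈-sym (≈-trans (+-cong (*-cong (≈-refl {C k}) (p₊ k)) (≈-refl {D k * p k}))
      (pointwise λ m → QS.solve 5 (λ c p x a b → c :* (p :* (x :- a)) :+ ((a :- b) :* c) :* p := (c :* p) :* (x :- b)) ≡.refl
        (seq (C k) m) (seq (p k) m) (seq x m) (seq (a k) m) (seq (b n) m)))
    top : (Σ[ k ≤ n ] D k * p k) ≈ D 0 * p 0 + B
    top = ≈-sym (≈-trans (Σ-last n (λ k → D k * p k))
      (≈-trans (+-cong ≈-refl (*-cong (*-cong (≈-refl {a (suc n) - b n}) (connection-zero a b {n} ℕ.≤-refl)) (≈-refl {p (suc n)})))
      (pointwise λ m → QS.solve 3 (λ s u v → s :+ (u :* con 0ℚ) :* v := s) ≡.refl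
        (seq (Σ[ k ≤ n ] D k * p k) m) (seq (a (suc n) - b n) m) (seq (p (suc n)) m))))

stirling₁-exists : ∀ lam → ∃ (IsStirling₁ lam)
stirling₁-exists lam = connection (λ k → fromℕᵣ k * lam) fromℕᵣ , λ n x →
  connection-spec _ _ x (ff[ lam ] x) (ff x) ≈-refl ≈-refl (λ _ → ≈-refl) (λ _ → ≈-refl) n

stirling₂-exists : ∀ lam → ∃ (IsStirling₂ lam)
stirling₂-exists lam = connection fromℕᵣ (λ k → fromℕᵣ k * lam) , λ n x →
  connection-spec _ _ x (ff x) (ff[ lam ] x) ≈-refl ≈-refl (λ _ → ≈-refl) (λ _ → ≈-refl) n

{-# OPTIONS --safe #-}

-- Write Δ f (x) = f (x + 1) − f (x) and T = Σ_m (−½)ᵐ Δᵐ = 2 / (2 + Δ), a linear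
-- operator on functions, well defined on those killed by a power of Δ.  The
-- addition formula e_λ^{x+1} = e_λ e_λ^x gives 𝓔ₙ(x + 1) + 𝓔ₙ(x) = 2 (x)_{n,λ},
-- that is 𝓔ₙ = T (x)_{n,λ}, while Δ lowers binomial coefficients, so that
-- T binom(x,n) = Σ_k binom(x,k) (−½)ⁿ⁻ᵏ.  Applying T to the two identities that
-- define the Stirling numbers gives the theorem.
module Submission where

open import Algebra.Bundles using (CommutativeRing)
import Algebra.Properties.Semiring.Sum as SemiringSum
import Algebra.Solver.Ring as RingSolver
open import Algebra.Solver.Ring.AlmostCommutativeRing using (fromCommutativeRing; _-Raw-AlmostCommutative⟶_)
open import Data.Fin.Base using (toℕ)
open import Data.Integer.Base as ℤ using (+_)
import Data.Integer.Properties as ℤ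
open import Data.Maybe.Base as Maybe using ()
open import Data.Nat.Base as ℕ using (ℕ; zero; suc; _∸_; _!; z≤n; s≤s)
import Data.Nat.Properties as ℕ
open import Data.Product.Base using (_×_; _,_)
open import Data.Rational.Base as ℚ using (0ℚ; 1ℚ; ½; -½)
import Data.Rational.Properties as ℚ
import Data.Rational.Unnormalised.Base as ℚᵘ
import Data.Rational.Unnormalised.Properties as ℚᵘ
open import Function.Base using (_∘_)
open import Relation.Binary.PropositionalEquality as ≡ using (_≡_; cong; cong₂)
open import Relation.Nullary.Decidable.Core using (dec⇒maybe)
open import Defs

private
  module R = CommutativeRing ℝ-commutativeRing
  module Sum = SemiringSum R.semiring

open import Relation.Binary.Reasoning.Setoid R.setoid

-- The solver takes rational coefficients, so that ½ and -½ are normalised as constants and compared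
-- by decidable equality.
ι-morphism : CommutativeRing.rawRing ℚ.+-*-commutativeRing -Raw-AlmostCommutative⟶ fromCommutativeRing ℝ-commutativeRing
ι-morphism = record
  { ⟦_⟧    = ι
  ; +-homo = λ _ _ → pointwise λ _ → ≡.refl
  ; *-homo = λ _ _ → pointwise λ _ → ≡.refl
  ; -‿homo = λ _ → pointwise λ _ → ≡.refl
  ; 0-homo = ≈-refl
  ; 1-homo = ≈-refl
  }

≡⇒≈ : ∀ {x y : ℝ} → x ≡ y → x ≈ y
≡⇒≈ ≡.refl = ≈-refl

open RingSolver (CommutativeRing.rawRing ℚ.+-*-commutativeRing) (fromCommutativeRing ℝ-commutativeRing)
  ι-morphism (λ p q → Maybe.map (λ p≡q → ≡⇒≈ (cong ι p≡q)) (dec⇒maybe (p ℚ.≟ q)))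
  using (solve; _:=_; _:+_; _:*_; _:-_; :-_; con)

-- Naturals and factorials as reals

-- Addition on `ℚ` reduces to lowest terms, which blocks computation on variables; injectivity of
-- `toℚᵘ` moves the claim to unnormalised fractions.
fromℚᵘ-homo-+ : ∀ p q → ℚ.fromℚᵘ (p ℚᵘ.+ q) ≡ ℚ.fromℚᵘ p ℚ.+ ℚ.fromℚᵘ q
fromℚᵘ-homo-+ p q = ℚ.toℚᵘ-injective (ℚᵘ.≃-trans (ℚ.toℚᵘ-fromℚᵘ (p ℚᵘ.+ q)) (ℚᵘ.≃-sym
  (ℚᵘ.≃-trans (ℚ.toℚᵘ-homo-+ (ℚ.fromℚᵘ p) (ℚ.fromℚᵘ q)) (ℚᵘ.+-cong (ℚ.toℚᵘ-fromℚᵘ p) (ℚ.toℚᵘ-fromℚᵘ q)))))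

fromℚᵘ-homo-* : ∀ p q → ℚ.fromℚᵘ (p ℚᵘ.* q) ≡ ℚ.fromℚᵘ p ℚ.* ℚ.fromℚᵘ q
fromℚᵘ-homo-* p q = ℚ.toℚᵘ-injective (ℚᵘ.≃-trans (ℚ.toℚᵘ-fromℚᵘ (p ℚᵘ.* q)) (ℚᵘ.≃-sym
  (ℚᵘ.≃-trans (ℚ.toℚᵘ-homo-* (ℚ.fromℚᵘ p) (ℚ.fromℚᵘ q)) (ℚᵘ.*-cong (ℚ.toℚᵘ-fromℚᵘ p) (ℚ.toℚᵘ-fromℚᵘ q)))))

fromℕᵣ-+ : ∀ m n → fromℕᵣ (m ℕ.+ n) ≈ fromℕᵣ m + fromℕᵣ n
fromℕᵣ-+ m n = pointwise λ _ → ≡.trans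
  (cong (ℚ._/ 1) (≡.trans (ℤ.pos-+ m n) (≡.sym (cong₂ ℤ._+_ (ℤ.*-identityʳ (+ m)) (ℤ.*-identityʳ (+ n))))))
  (fromℚᵘ-homo-+ (ℚᵘ.mkℚᵘ (+ m) 0) (ℚᵘ.mkℚᵘ (+ n) 0))

fromℕᵣ-* : ∀ m n → fromℕᵣ (m ℕ.* n) ≈ fromℕᵣ m * fromℕᵣ n
fromℕᵣ-* m n = pointwise λ _ → ≡.trans (cong (ℚ._/ 1) (ℤ.pos-* m n))
  (fromℚᵘ-homo-* (ℚᵘ.mkℚᵘ (+ m) 0) (ℚᵘ.mkℚᵘ (+ n) 0))

fromℕᵣ-suc : ∀ n → fromℕᵣ (suc n) ≈ 1ℝ + fromℕᵣ n
fromℕᵣ-suc n = fromℕᵣ-+ 1 n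

n/1*1/n≡1 : ∀ n .{{_ : ℕ.NonZero n}} → (+ n ℚ./ 1) ℚ.* (+ 1 ℚ./ n) ≡ 1ℚ
n/1*1/n≡1 (suc n) = ≡.trans
  (≡.sym (fromℚᵘ-homo-* (ℚᵘ.mkℚᵘ (+ suc n) 0) (ℚᵘ.mkℚᵘ (+ 1) n)))
  (ℚ.fromℚᵘ-cong {ℚᵘ.mkℚᵘ (+ suc n) 0 ℚᵘ.* ℚᵘ.mkℚᵘ (+ 1) n} {ℚᵘ.1ℚᵘ}
    (ℚᵘ.*≡* (≡.trans (ℤ.*-identityʳ _) (≡.trans (ℤ.*-identityʳ _) (≡.sym (≡.trans (ℤ.*-identityˡ _) (cong (+_) (ℕ.*-identityˡ (suc n)))))))))

!*1/! : ∀ k → fromℕᵣ (k !) * 1/ k ! ≈ 1ℝ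
!*1/! k = pointwise λ _ → n/1*1/n≡1 (k !) {{k ℕ.!≢0}}

n!*[z*1/n!] : ∀ n z → fromℕᵣ (n !) * (z * 1/ n !) ≈ z
n!*[z*1/n!] n z = begin
  fromℕᵣ (n !) * (z * 1/ n !) ≈⟨ solve 3 (λ f z i → f :* (z :* i) := z :* (f :* i)) ≈-refl (fromℕᵣ (n !)) z (1/ n !) ⟩
  z * (fromℕᵣ (n !) * 1/ n !) ≈⟨ *-cong ≈-refl (!*1/! n) ⟩
  z * 1ℝ                      ≈⟨ R.*-identityʳ z ⟩
  z                           ∎

suc*1/suc! : ∀ k → fromℕᵣ (suc k) * 1/ (suc k) ! ≈ 1/ k !
suc*1/suc! k = begin
  s * i'                 ≈⟨ solve 2 (λ s i' → s :* i' := con 1ℚ :* (s :* i')) ≈-refl s i' ⟩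
  1ℝ * (s * i')          ≈⟨ *-cong (!*1/! k) ≈-refl ⟨
  f * i * (s * i')       ≈⟨ solve 4 (λ f i s i' → f :* i :* (s :* i') := s :* f :* i' :* i) ≈-refl f i s i' ⟩
  s * f * i' * i         ≈⟨ *-cong (*-cong (fromℕᵣ-* (suc k) (k !)) ≈-refl) ≈-refl ⟨
  fromℕᵣ (suc k !) * i' * i ≈⟨ *-cong (!*1/! (suc k)) ≈-refl ⟩
  1ℝ * i                 ≈⟨ R.*-identityˡ i ⟩
  i                      ∎
  where
  s f i i' : ℝ
  s = fromℕᵣ (suc k)
  f = fromℕᵣ (k !)
  i = 1/ k !
  i' = 1/ (suc k) !

-- The inverse of n + 1 is n!/(n + 1)!, so the reciprocal factorials already provide the division.
*-cancelˡ-suc : ∀ n {x y} → fromℕᵣ (suc n) * x ≈ fromℕᵣ (suc n) * y → x ≈ y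
*-cancelˡ-suc n {x} {y} eq = begin
  x                      ≈⟨ insert x ⟩
  f * i * (s * x)        ≈⟨ *-cong ≈-refl eq ⟩
  f * i * (s * y)        ≈⟨ insert y ⟨
  y                      ∎
  where
  s f i : ℝ
  s = fromℕᵣ (suc n)
  f = fromℕᵣ (n !)
  i = 1/ (suc n) !
  insert : ∀ z → z ≈ f * i * (s * z)
  insert z = begin
    z                        ≈⟨ R.*-identityˡ z ⟨
    1ℝ * z                   ≈⟨ *-cong (!*1/! (suc n)) ≈-refl ⟨
    fromℕᵣ (suc n !) * i * z ≈⟨ *-cong (*-cong (fromℕᵣ-* (suc n) (n !)) ≈-refl) ≈-refl ⟩
    s * f * i * z            ≈⟨ solve 4 (λ f i s z → s :* f :* i :* z := f :* i :* (s :* z)) ≈-refl f i s z ⟩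
    f * i * (s * z)          ∎

-- Finite sums

Σ-cong≤ : ∀ n {f g : ℕ → ℝ} → (∀ {k} → k ℕ.≤ n → f k ≈ g k) → Σ≤ n f ≈ Σ≤ n g
Σ-cong≤ zero    f≈g = +-cong (f≈g z≤n) ≈-refl
Σ-cong≤ (suc n) f≈g = +-cong (f≈g z≤n) (Σ-cong≤ n (f≈g ∘ s≤s))

Σ-cong : ∀ n {f g : ℕ → ℝ} → (∀ k → f k ≈ g k) → Σ≤ n f ≈ Σ≤ n g
Σ-cong n f≈g = Σ-cong≤ n (λ {k} _ → f≈g k)

Σ-+ : ∀ n (f g : ℕ → ℝ) → Σ≤ n (λ k → f k + g k) ≈ Σ≤ n f + Σ≤ n g
Σ-+ n f g = Sum.∑-distrib-+ {suc n} (f ∘ toℕ) (g ∘ toℕ)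

*-distribˡ-Σ : ∀ n c (f : ℕ → ℝ) → c * Σ≤ n f ≈ Σ≤ n (λ k → c * f k)
*-distribˡ-Σ n c f = Sum.*-distribˡ-sum {suc n} c (f ∘ toℕ)

Σ-zero : ∀ n {f : ℕ → ℝ} → (∀ {k} → k ℕ.≤ n → f k ≈ 0ℝ) → Σ≤ n f ≈ 0ℝ
Σ-zero n f≈0 = ≈-trans (Σ-cong≤ n f≈0) (Sum.sum-replicate-zero (suc n))

-- The ring of formal power series

infixl 8 _·_

_·_ : ℝ → Series → Series
(c · f) n = c * f n

⊛-cong : ∀ {f f' g g' : Series} → (∀ n → f n ≈ f' n) → (∀ n → g n ≈ g' n) → ∀ n → (f ⊛ g) n ≈ (f' ⊛ g') n
⊛-cong f≈ g≈ n = Σ-cong n λ k → *-cong (f≈ k) (g≈ (n ∸ k))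

⊛-distribʳ-⊕ : ∀ f g h n → ((f ⊕ g) ⊛ h) n ≈ (f ⊛ h) n + (g ⊛ h) n
⊛-distribʳ-⊕ f g h n = ≈-trans (Σ-cong n λ k → R.distribʳ (h (n ∸ k)) (f k) (g k)) (Σ-+ n (λ k → f k * h (n ∸ k)) (λ k → g k * h (n ∸ k)))

⊛-distribˡ-⊕ : ∀ f g h n → (f ⊛ (g ⊕ h)) n ≈ (f ⊛ g) n + (f ⊛ h) n
⊛-distribˡ-⊕ f g h n = ≈-trans (Σ-cong n λ k → R.distribˡ (f k) (g (n ∸ k)) (h (n ∸ k))) (Σ-+ n (λ k → f k * g (n ∸ k)) (λ k → f k * h (n ∸ k)))

·-⊛ : ∀ c f g n → ((c · f) ⊛ g) n ≈ c * (f ⊛ g) n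
·-⊛ c f g n = ≈-trans (Σ-cong n λ k → R.*-assoc c (f k) (g (n ∸ k))) (≈-sym (*-distribˡ-Σ n c (λ k → f k * g (n ∸ k))))

-- Unfolding `⊛` splits off the term with `f 0`; here the term with `g 0` is split off instead.
-- Commutativity follows by matching the two splittings.
⊛-suc-last : ∀ f g n → (f ⊛ g) (suc n) ≈ (f ⊛ (g ∘ suc)) n + f (suc n) * g 0
⊛-suc-last f g zero    = solve 2 (λ a b → a :+ (b :+ con 0ℚ) := a :+ con 0ℚ :+ b) ≈-refl (f 0 * g 1) (f 1 * g 0)
⊛-suc-last f g (suc n) = ≈-trans (+-cong ≈-refl (⊛-suc-last (f ∘ suc) g n)) (≈-sym (R.+-assoc _ _ _))

⊛-comm : ∀ f g n → (f ⊛ g) n ≈ (g ⊛ f) n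
⊛-comm f g zero    = +-cong (R.*-comm _ _) ≈-refl
⊛-comm f g (suc n) = begin
  f 0 * g (suc n) + ((f ∘ suc) ⊛ g) n ≈⟨ +-cong (R.*-comm _ _) (⊛-comm (f ∘ suc) g n) ⟩
  g (suc n) * f 0 + (g ⊛ (f ∘ suc)) n ≈⟨ R.+-comm _ _ ⟩
  (g ⊛ (f ∘ suc)) n + g (suc n) * f 0 ≈⟨ ⊛-suc-last g f n ⟨
  (g ⊛ f) (suc n)                     ∎

⊛-assoc : ∀ f g h n → ((f ⊛ g) ⊛ h) n ≈ (f ⊛ (g ⊛ h)) n
⊛-assoc f g h zero    = solve 3 (λ a b c → (a :* b :+ con 0ℚ) :* c :+ con 0ℚ := a :* (b :* c :+ con 0ℚ) :+ con 0ℚ) ≈-refl (f 0) (g 0) (h 0)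
⊛-assoc f g h (suc n) = begin
  -- By computation, `(f ⊛ g) ∘ suc` is the series `f 0 · (g ∘ suc) ⊕ ((f ∘ suc) ⊛ g)`.
  (f 0 * g 0 + 0ℝ) * h (suc n) + ((f 0 · (g ∘ suc) ⊕ ((f ∘ suc) ⊛ g)) ⊛ h) n
    ≈⟨ +-cong ≈-refl (≈-trans (⊛-distribʳ-⊕ (f 0 · (g ∘ suc)) ((f ∘ suc) ⊛ g) h n) (+-cong (·-⊛ (f 0) (g ∘ suc) h n) (⊛-assoc (f ∘ suc) g h n))) ⟩
  (f 0 * g 0 + 0ℝ) * h (suc n) + (f 0 * ((g ∘ suc) ⊛ h) n + ((f ∘ suc) ⊛ (g ⊛ h)) n)
    ≈⟨ solve 5 (λ a b c d e → (a :* b :+ con 0ℚ) :* c :+ (a :* d :+ e) := a :* (b :* c :+ d) :+ e) ≈-refl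
         (f 0) (g 0) (h (suc n)) (((g ∘ suc) ⊛ h) n) (((f ∘ suc) ⊛ (g ⊛ h)) n) ⟩
  f 0 * (g ⊛ h) (suc n) + ((f ∘ suc) ⊛ (g ⊛ h)) n ∎

constS-⊛ : ∀ c f n → (constS c ⊛ f) n ≈ c * f n
constS-⊛ c f zero    = R.+-identityʳ _
constS-⊛ c f (suc n) = ≈-trans (+-cong ≈-refl (Σ-zero n λ {k} _ → R.zeroˡ (f (n ∸ k)))) (R.+-identityʳ _)

-- θ = t d/dt
θ : Series → Series
θ f n = fromℕᵣ n * f n

-- The Leibniz rule: in the term of index k the factor n splits as k + (n ∸ k), which needs k ≤ n.
θ-⊛ : ∀ f g n → θ (f ⊛ g) n ≈ (θ f ⊛ g) n + (f ⊛ θ g) n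
θ-⊛ f g n = ≈-trans (*-distribˡ-Σ n (fromℕᵣ n) (λ k → f k * g (n ∸ k)))
  (≈-trans (Σ-cong≤ n leibniz) (Σ-+ n (λ k → θ f k * g (n ∸ k)) (λ k → f k * θ g (n ∸ k))))
  where
  leibniz : ∀ {k} → k ℕ.≤ n → fromℕᵣ n * (f k * g (n ∸ k)) ≈ θ f k * g (n ∸ k) + f k * θ g (n ∸ k)
  leibniz {k} k≤n = ≈-trans
    (*-cong (≈-trans (≡⇒≈ (cong fromℕᵣ (≡.sym (ℕ.m+[n∸m]≡n k≤n)))) (fromℕᵣ-+ k (n ∸ k))) ≈-refl)
    (solve 4 (λ k l a b → (k :+ l) :* (a :* b) := k :* a :* b :+ a :* (l :* b)) ≈-refl
      (fromℕᵣ k) (fromℕᵣ (n ∸ k)) (f k) (g (n ∸ k)))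

-- The addition formula for the degenerate exponential

module _ (lam : ℝ) where

  -- The differential equation (1 + λt) d′ = x d of d = (1 + λt)^{x/λ}, read off coefficient by
  -- coefficient.
  θ-dexp-suc : ∀ x n → θ (dexp lam x) (suc n) ≈ (x - fromℕᵣ n * lam) * dexp lam x n
  θ-dexp-suc x n = ≈-trans
    (solve 4 (λ s p z i → s :* (p :* z :* i) := z :* (p :* (s :* i))) ≈-refl
      (fromℕᵣ (suc n)) (ff[ lam ] x n) (x - fromℕᵣ n * lam) (1/ (suc n) !))
    (*-cong ≈-refl (*-cong ≈-refl (suc*1/suc! n)))

  -- The same equation, as θ d = t (x d - λ θ d), multiplied by `g`. The first term of the
  -- convolution vanishes because θ d has constant term 0.
  θ-dexp-⊛-suc : ∀ x g n → (θ (dexp lam x) ⊛ g) (suc n) ≈ x * (dexp lam x ⊛ g) n - lam * (θ (dexp lam x) ⊛ g) n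
  θ-dexp-⊛-suc x g n = begin
    0ℝ * d 0 * g (suc n) + ((θ d ∘ suc) ⊛ g) n
      ≈⟨ +-cong (≈-trans (*-cong (R.zeroˡ (d 0)) ≈-refl) (R.zeroˡ _)) (⊛-cong {g = g} step (λ _ → ≈-refl) n) ⟩
    0ℝ + ((x · d ⊕ (- lam) · θ d) ⊛ g) n
      ≈⟨ ≈-trans (R.+-identityˡ _) (⊛-distribʳ-⊕ (x · d) ((- lam) · θ d) g n) ⟩
    ((x · d) ⊛ g) n + (((- lam) · θ d) ⊛ g) n
      ≈⟨ +-cong (·-⊛ x d g n) (·-⊛ (- lam) (θ d) g n) ⟩
    x * (d ⊛ g) n + (- lam) * (θ d ⊛ g) n
      ≈⟨ solve 3 (λ a l b → a :+ (:- l) :* b := a :- l :* b) ≈-refl (x * (d ⊛ g) n) lam ((θ d ⊛ g) n) ⟩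
    x * (d ⊛ g) n - lam * (θ d ⊛ g) n ∎
    where
    d : Series
    d = dexp lam x
    step : ∀ k → θ d (suc k) ≈ (x · d ⊕ (- lam) · θ d) k
    step k = ≈-trans (θ-dexp-suc x k)
      (solve 4 (λ x n l d → (x :- n :* l) :* d := x :* d :+ (:- l) :* (n :* d)) ≈-refl x (fromℕᵣ k) lam (d k))

  -- Both sides satisfy (n + 1) cₙ₊₁ = (x + y − nλ) cₙ.
  dexp-⊛ : ∀ x y n → (dexp lam x ⊛ dexp lam y) n ≈ dexp lam (x + y) n
  dexp-⊛ x y zero    = pointwise λ _ → ≡.refl
  dexp-⊛ x y (suc n) = *-cancelˡ-suc n (begin
    θ (d ⊛ e) (suc n)
      ≈⟨ θ-⊛ d e (suc n) ⟩
    (θ d ⊛ e) (suc n) + (d ⊛ θ e) (suc n)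
      ≈⟨ +-cong (θ-dexp-⊛-suc x e n) (≈-trans (⊛-comm d (θ e) (suc n)) (θ-dexp-⊛-suc y d n)) ⟩
    (x * (d ⊛ e) n - lam * (θ d ⊛ e) n) + (y * (e ⊛ d) n - lam * (θ e ⊛ d) n)
      ≈⟨ +-cong ≈-refl (+-cong (*-cong ≈-refl (⊛-comm e d n)) (neg-cong (*-cong ≈-refl (⊛-comm (θ e) d n)))) ⟩
    (x * (d ⊛ e) n - lam * (θ d ⊛ e) n) + (y * (d ⊛ e) n - lam * (d ⊛ θ e) n)
      ≈⟨ solve 6 (λ x y l c a b → (x :* c :- l :* a) :+ (y :* c :- l :* b) := (x :+ y) :* c :- l :* (a :+ b)) ≈-refl
           x y lam ((d ⊛ e) n) ((θ d ⊛ e) n) ((d ⊛ θ e) n) ⟩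
    (x + y) * (d ⊛ e) n - lam * ((θ d ⊛ e) n + (d ⊛ θ e) n)
      -- The Leibniz rule backwards merges the two θ terms into n times one coefficient, so the
      -- recursion involves `(d ⊛ e) n` alone.
      ≈⟨ +-cong ≈-refl (neg-cong (*-cong ≈-refl (θ-⊛ d e n))) ⟨
    (x + y) * (d ⊛ e) n - lam * (fromℕᵣ n * (d ⊛ e) n)
      ≈⟨ solve 4 (λ s l n c → s :* c :- l :* (n :* c) := (s :- n :* l) :* c) ≈-refl (x + y) lam (fromℕᵣ n) ((d ⊛ e) n) ⟩
    (x + y - fromℕᵣ n * lam) * (d ⊛ e) n
      ≈⟨ *-cong ≈-refl (dexp-⊛ x y n) ⟩
    (x + y - fromℕᵣ n * lam) * dexp lam (x + y) n
      ≈⟨ θ-dexp-suc (x + y) n ⟨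
    θ (dexp lam (x + y)) (suc n) ∎)
    where
    d e : Series
    d = dexp lam x
    e = dexp lam y

  -- The functional equation of the degenerate Euler polynomials

  dexp-+1 : ∀ x n → dexp lam (x + 1ℝ) n ≈ (dexp lam 1ℝ ⊛ dexp lam x) n
  dexp-+1 x n = ≈-trans (≈-sym (dexp-⊛ x 1ℝ n)) (⊛-comm (dexp lam x) (dexp lam 1ℝ) n)

  -- This is 𝓔ₙ(x)/n!. Dropping the factorial leaves a plain convolution, to which the series laws
  -- apply.
  eulerFn : ℕ → ℝ → ℝ
  eulerFn n x = (eulerSeries lam ⊛ dexp lam x) n

  eulerSeries-⊛-dexp+1 : ∀ n → (eulerSeries lam ⊛ dexp+1 lam) n ≈ constS (fromℕᵣ 2) n
  eulerSeries-⊛-dexp+1 n = begin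
    ((two ⊛ r) ⊛ D) n      ≈⟨ ⊛-assoc two r D n ⟩
    (two ⊛ (r ⊛ D)) n      ≈⟨ ⊛-cong {f = two} (λ _ → ≈-refl) (λ k → ≈-trans (⊛-comm r D k) (dexp+1-recip lam k)) n ⟩
    (two ⊛ constS 1ℝ) n    ≈⟨ ⊛-comm two (constS 1ℝ) n ⟩
    (constS 1ℝ ⊛ two) n    ≈⟨ constS-⊛ 1ℝ two n ⟩
    1ℝ * two n             ≈⟨ R.*-identityˡ _ ⟩
    two n                  ∎
    where
    two r D : Series
    two = constS (fromℕᵣ 2)
    D = dexp+1 lam
    r = recip D (ι ½)

  -- Since e_λ^{x+1} + e_λ^x = (e_λ + 1) e_λ^x, the sum cancels the denominator of `eulerSeries`.
  eulerFn-+1 : ∀ n x → eulerFn n (x + 1ℝ) + eulerFn n x ≈ fromℕᵣ 2 * dexp lam x n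
  eulerFn-+1 n x = begin
    (E ⊛ dexp lam (x + 1ℝ)) n + (E ⊛ d) n  ≈⟨ ⊛-distribˡ-⊕ E (dexp lam (x + 1ℝ)) d n ⟨
    (E ⊛ (dexp lam (x + 1ℝ) ⊕ d)) n        ≈⟨ ⊛-cong {f = E} (λ _ → ≈-refl) factor n ⟩
    (E ⊛ (dexp+1 lam ⊛ d)) n               ≈⟨ ⊛-assoc E (dexp+1 lam) d n ⟨
    ((E ⊛ dexp+1 lam) ⊛ d) n               ≈⟨ ⊛-cong {g = d} eulerSeries-⊛-dexp+1 (λ _ → ≈-refl) n ⟩
    (constS (fromℕᵣ 2) ⊛ d) n              ≈⟨ constS-⊛ (fromℕᵣ 2) d n ⟩
    fromℕᵣ 2 * d n                         ∎
    where
    E d : Series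
    E = eulerSeries lam
    d = dexp lam x
    factor : ∀ k → (dexp lam (x + 1ℝ) ⊕ d) k ≈ (dexp+1 lam ⊛ d) k
    factor k = begin
      dexp lam (x + 1ℝ) k + d k                    ≈⟨ +-cong (dexp-+1 x k) (≈-sym (R.*-identityˡ _)) ⟩
      (dexp lam 1ℝ ⊛ d) k + 1ℝ * d k               ≈⟨ +-cong ≈-refl (constS-⊛ 1ℝ d k) ⟨
      (dexp lam 1ℝ ⊛ d) k + (constS 1ℝ ⊛ d) k      ≈⟨ ⊛-distribʳ-⊕ (dexp lam 1ℝ) (constS 1ℝ) d k ⟨
      (dexp+1 lam ⊛ d) k                           ∎

-- The operator 2 / (2 + Δ)

Δ : (ℝ → ℝ) → ℝ → ℝ
Δ f x = f (x + 1ℝ) - f x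

-- Δⁿ f = 0, which holds for polynomial functions of degree below n; it stands in for a degree
-- bound.
KilledBy : ℕ → (ℝ → ℝ) → Set
KilledBy zero    f = ∀ x → f x ≈ 0ℝ
KilledBy (suc n) f = KilledBy n (Δ f)

-- T n  is  Σ_{m ≤ n} (−½)ᵐ Δᵐ.
T : ℕ → (ℝ → ℝ) → ℝ → ℝ
T zero    f x = f x
T (suc n) f x = f x + ι -½ * T n (Δ f) x

Δ-cong : ∀ {f g : ℝ → ℝ} → (∀ x → f x ≈ g x) → ∀ x → Δ f x ≈ Δ g x
Δ-cong f≈g x = +-cong (f≈g (x + 1ℝ)) (neg-cong (f≈g x))

Δ-* : ∀ c f x → Δ (λ y → c * f y) x ≈ c * Δ f x
Δ-* c f x = solve 3 (λ c a b → c :* a :- c :* b := c :* (a :- b)) ≈-refl c (f (x + 1ℝ)) (f x)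

Δ-Σ : ∀ n (c : ℕ → ℝ) (p : ℕ → ℝ → ℝ) x →
      Δ (λ y → Σ[ k ≤ n ] c k * p k y) x ≈ (Σ[ k ≤ n ] c k * Δ (p k) x)
Δ-Σ zero    c p x = solve 3 (λ c a b → c :* a :+ con 0ℚ :- (c :* b :+ con 0ℚ) := c :* (a :- b) :+ con 0ℚ) ≈-refl
  (c 0) (p 0 (x + 1ℝ)) (p 0 x)
Δ-Σ (suc n) c p x = ≈-trans
  (solve 5 (λ c a b s t → c :* a :+ s :- (c :* b :+ t) := c :* (a :- b) :+ (s :- t)) ≈-refl
    (c 0) (p 0 (x + 1ℝ)) (p 0 x) (Σ≤ n λ k → c (suc k) * p (suc k) (x + 1ℝ)) (Σ≤ n λ k → c (suc k) * p (suc k) x))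
  (+-cong ≈-refl (Δ-Σ n (c ∘ suc) (p ∘ suc) x))

KilledBy-cong : ∀ n {f g} → (∀ x → f x ≈ g x) → KilledBy n f → KilledBy n g
KilledBy-cong zero    f≈g f≈0 x = ≈-trans (≈-sym (f≈g x)) (f≈0 x)
KilledBy-cong (suc n) f≈g       = KilledBy-cong n (Δ-cong f≈g)

KilledBy-zero : ∀ n {f} → (∀ x → f x ≈ 0ℝ) → KilledBy n f
KilledBy-zero zero    f≈0 = f≈0
KilledBy-zero (suc n) f≈0 = KilledBy-zero n λ x → ≈-trans (+-cong (f≈0 (x + 1ℝ)) (neg-cong (f≈0 x))) (R.-‿inverseʳ 0ℝ)

KilledBy-Σ : ∀ m n (c : ℕ → ℝ) (p : ℕ → ℝ → ℝ) → (∀ {k} → k ℕ.≤ n → KilledBy m (p k)) → KilledBy m (λ x → Σ[ k ≤ n ] c k * p k x)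
KilledBy-Σ zero    n c p killed x = Σ-zero n λ {k} k≤n → ≈-trans (*-cong ≈-refl (killed k≤n x)) (R.zeroʳ (c k))
KilledBy-Σ (suc m) n c p killed = KilledBy-cong m (λ x → ≈-sym (Δ-Σ n c p x)) (KilledBy-Σ m n c (Δ ∘ p) killed)

T-cong : ∀ n {f g} → (∀ x → f x ≈ g x) → ∀ x → T n f x ≈ T n g x
T-cong zero    f≈g x = f≈g x
T-cong (suc n) f≈g x = +-cong (f≈g x) (*-cong ≈-refl (T-cong n (Δ-cong f≈g) x))

T-* : ∀ n c f x → T n (λ y → c * f y) x ≈ c * T n f x
T-* zero    c f x = ≈-refl
T-* (suc n) c f x = ≈-trans
  (+-cong ≈-refl (*-cong ≈-refl (≈-trans (T-cong n (Δ-* c f) x) (T-* n c (Δ f) x))))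
  (solve 3 (λ c a t → c :* a :+ con -½ :* (c :* t) := c :* (a :+ con -½ :* t)) ≈-refl c (f x) (T n (Δ f) x))

T-Σ : ∀ m n (c : ℕ → ℝ) (p : ℕ → ℝ → ℝ) x →
      T m (λ y → Σ[ k ≤ n ] c k * p k y) x ≈ (Σ[ k ≤ n ] c k * T m (p k) x)
T-Σ zero    n c p x = ≈-refl
T-Σ (suc m) n c p x = begin
  (Σ[ k ≤ n ] c k * p k x) + ι -½ * T m (Δ (λ y → Σ[ k ≤ n ] c k * p k y)) x
    ≈⟨ +-cong ≈-refl (*-cong ≈-refl (≈-trans (T-cong m (Δ-Σ n c p) x) (T-Σ m n c (Δ ∘ p) x))) ⟩
  (Σ[ k ≤ n ] c k * p k x) + ι -½ * (Σ[ k ≤ n ] c k * T m (Δ (p k)) x)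
    ≈⟨ +-cong ≈-refl (*-distribˡ-Σ n (ι -½) (λ k → c k * T m (Δ (p k)) x)) ⟩
  (Σ[ k ≤ n ] c k * p k x) + (Σ[ k ≤ n ] ι -½ * (c k * T m (Δ (p k)) x))
    ≈⟨ Σ-+ n (λ k → c k * p k x) (λ k → ι -½ * (c k * T m (Δ (p k)) x)) ⟨
  (Σ[ k ≤ n ] (c k * p k x + ι -½ * (c k * T m (Δ (p k)) x)))
    ≈⟨ Σ-cong n (λ k → solve 3 (λ c a t → c :* a :+ con -½ :* (c :* t) := c :* (a :+ con -½ :* t)) ≈-refl
         (c k) (p k x) (T m (Δ (p k)) x)) ⟩
  (Σ[ k ≤ n ] c k * T (suc m) (p k) x) ∎

-- A vanishing function is 0 times itself, so homogeneity of `T` is enough.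
T-zero : ∀ n {f} → (∀ x → f x ≈ 0ℝ) → ∀ x → T n f x ≈ 0ℝ
T-zero n {f} f≈0 x = begin
  T n f x                 ≈⟨ T-cong n (λ y → ≈-trans (f≈0 y) (≈-sym (R.zeroˡ (f y)))) x ⟩
  T n (λ y → 0ℝ * f y) x  ≈⟨ T-* n 0ℝ f x ⟩
  0ℝ * T n f x            ≈⟨ R.zeroˡ _ ⟩
  0ℝ                      ∎

-- A geometric series: f(y + 1) + f(y) is (2 + Δ) f, and Σ_{m≤n} (-Δ/2)ᵐ (2 + Δ) = 2 - 2 (-Δ/2)ⁿ⁺¹.
-- The remainder vanishes because Δⁿ⁺¹ kills `f`; hence `suc n` in the hypothesis against `n` in
-- `T`.
T-inverse : ∀ n f → KilledBy (suc n) f → ∀ x → T n (λ y → f (y + 1ℝ) + f y) x ≈ fromℕᵣ 2 * f x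
T-inverse zero f Δf≈0 x = begin
  f (x + 1ℝ) + f x      ≈⟨ solve 2 (λ a b → a :+ b := (a :- b) :+ con (+ 2 ℚ./ 1) :* b) ≈-refl (f (x + 1ℝ)) (f x) ⟩
  Δ f x + fromℕᵣ 2 * f x ≈⟨ +-cong (Δf≈0 x) ≈-refl ⟩
  0ℝ + fromℕᵣ 2 * f x    ≈⟨ R.+-identityˡ _ ⟩
  fromℕᵣ 2 * f x         ∎
T-inverse (suc n) f killed x = begin
  f (x + 1ℝ) + f x + ι -½ * T n (Δ (λ y → f (y + 1ℝ) + f y)) x
    ≈⟨ +-cong ≈-refl (*-cong ≈-refl (T-cong n (λ y →
         solve 3 (λ a b c → (a :+ b) :- (b :+ c) := (a :- b) :+ (b :- c)) ≈-refl (f (y + 1ℝ + 1ℝ)) (f (y + 1ℝ)) (f y)) x)) ⟩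
  f (x + 1ℝ) + f x + ι -½ * T n (λ y → Δ f (y + 1ℝ) + Δ f y) x
    ≈⟨ +-cong ≈-refl (*-cong ≈-refl (T-inverse n (Δ f) killed x)) ⟩
  f (x + 1ℝ) + f x + ι -½ * (fromℕᵣ 2 * (f (x + 1ℝ) - f x))
    ≈⟨ solve 2 (λ a b → a :+ b :+ con -½ :* (con (+ 2 ℚ./ 1) :* (a :- b)) := con (+ 2 ℚ./ 1) :* b) ≈-refl (f (x + 1ℝ)) (f x) ⟩
  fromℕᵣ 2 * f x ∎

-- T on the degenerate exponential and on binomial coefficients

module _ (lam : ℝ) where

  -- Δ e_λ^x = (e_λ - 1) e_λ^x, and e_λ - 1 has no constant term. Only coefficients of index at most
  -- n remain, so Δ lowers the degree in x.
  Δ-dexp-suc : ∀ n x → Δ (λ y → dexp lam y (suc n)) x ≈ (Σ[ k ≤ n ] dexp lam 1ℝ (suc k) * dexp lam x (n ∸ k))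
  Δ-dexp-suc n x = ≈-trans (+-cong (dexp-+1 lam x (suc n)) ≈-refl)
    (≈-trans (+-cong (+-cong (*-cong (R.*-identityˡ 1ℝ) ≈-refl) ≈-refl) ≈-refl)
      (solve 2 (λ d s → con 1ℚ :* d :+ s :- d := s) ≈-refl
        (dexp lam x (suc n)) (Σ[ k ≤ n ] dexp lam 1ℝ (suc k) * dexp lam x (n ∸ k))))

  -- The bound k ≤ n, in place of k = n, is what the induction uses: one Δ produces a combination of
  -- several lower indices, all to be killed by the same power.
  KilledBy-dexp : ∀ n {k} → k ℕ.≤ n → KilledBy (suc n) (λ x → dexp lam x k)
  KilledBy-dexp n       {zero}  _         = KilledBy-zero n λ _ → R.-‿inverseʳ _
  KilledBy-dexp (suc n) {suc k} (s≤s k≤n) = KilledBy-cong (suc n) (λ x → ≈-sym (Δ-dexp-suc k x))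
    (KilledBy-Σ (suc n) k (λ j → dexp lam 1ℝ (suc j)) (λ j x → dexp lam x (k ∸ j))
      λ {j} _ → KilledBy-dexp n (ℕ.≤-trans (ℕ.m∸n≤m k j) k≤n))

  -- By the functional equation `dexp` is (2 + Δ)/2 applied to `eulerFn`, and `T` undoes this. The
  -- order `n` may exceed `k`, so that one `T n` can act on a whole sum over k ≤ n.
  T-dexp : ∀ n {k} → k ℕ.≤ n → ∀ x → T n (λ y → dexp lam y k) x ≈ eulerFn lam k x
  T-dexp n {k} k≤n x = begin
    T n d x                                   ≈⟨ T-cong n half x ⟩
    T n (λ y → ι ½ * (h (y + 1ℝ) + h y)) x    ≈⟨ T-* n (ι ½) (λ y → h (y + 1ℝ) + h y) x ⟩
    ι ½ * T n (λ y → h (y + 1ℝ) + h y) x      ≈⟨ *-cong ≈-refl (T-inverse n h killed x) ⟩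
    ι ½ * (fromℕᵣ 2 * h x)                    ≈⟨ halve (h x) ⟩
    h x                                       ∎
    where
    d h : ℝ → ℝ
    d y = dexp lam y k
    h = eulerFn lam k
    halve : ∀ z → ι ½ * (fromℕᵣ 2 * z) ≈ z
    halve = solve 1 (λ z → con ½ :* (con (+ 2 ℚ./ 1) :* z) := z) ≈-refl
    half : ∀ y → d y ≈ ι ½ * (h (y + 1ℝ) + h y)
    half y = ≈-trans (≈-sym (halve (d y))) (*-cong ≈-refl (≈-sym (eulerFn-+1 lam k y)))
    -- As a function of y, the convolution `h` is a combination of the `dexp lam y (k ∸ j)` with
    -- constant coefficients `eulerSeries lam j`.
    killed : KilledBy (suc n) h
    killed = KilledBy-Σ (suc n) k (eulerSeries lam) (λ j y → dexp lam y (k ∸ j))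
      λ {j} _ → KilledBy-dexp n (ℕ.≤-trans (ℕ.m∸n≤m k j) k≤n)

  T-ff[] : ∀ n {k} → k ℕ.≤ n → ∀ x → T n (λ y → ff[ lam ] y k) x ≈ 𝓔 lam k x
  T-ff[] n {k} k≤n x = begin
    T n (λ y → ff[ lam ] y k) x                 ≈⟨ T-cong n (λ y → ≈-sym (n!*[z*1/n!] k (ff[ lam ] y k))) x ⟩
    T n (λ y → fromℕᵣ (k !) * dexp lam y k) x   ≈⟨ T-* n (fromℕᵣ (k !)) (λ y → dexp lam y k) x ⟩
    fromℕᵣ (k !) * T n (λ y → dexp lam y k) x   ≈⟨ *-cong ≈-refl (T-dexp n k≤n x) ⟩
    𝓔 lam k x                                   ∎

-- The shift puts a new factor x + 1 in front, while `ff` grows at the end; the induction closes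
-- because (x + 1) - (n + 1) = x - n.
ff-+1-suc : ∀ x n → ff (x + 1ℝ) (suc n) ≈ (x + 1ℝ) * ff x n
ff-+1-suc x zero    = solve 1 (λ x → con 1ℚ :* (x :+ con 1ℚ :- con 0ℚ) := (x :+ con 1ℚ) :* con 1ℚ) ≈-refl x
ff-+1-suc x (suc n) = ≈-trans
  (*-cong (ff-+1-suc x n) (+-cong ≈-refl (neg-cong (fromℕᵣ-suc n))))
  (solve 3 (λ x f n → (x :+ con 1ℚ) :* f :* (x :+ con 1ℚ :- (con 1ℚ :+ n)) := (x :+ con 1ℚ) :* (f :* (x :- n))) ≈-refl
    x (ff x n) (fromℕᵣ n))

-- Pascal's rule for a real upper argument: after the common factor `ff x n`, what remains is (x +
-- 1) - (x - n) = n + 1, which turns 1/(n + 1)! into 1/n!.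
Δ-binom-suc : ∀ n x → Δ (λ y → binom y (suc n)) x ≈ binom x n
Δ-binom-suc n x = begin
  ff (x + 1ℝ) (suc n) * i' - ff x n * (x - fromℕᵣ n) * i'
    ≈⟨ +-cong (*-cong (ff-+1-suc x n) ≈-refl) ≈-refl ⟩
  (x + 1ℝ) * ff x n * i' - ff x n * (x - fromℕᵣ n) * i'
    ≈⟨ solve 4 (λ x f n i → (x :+ con 1ℚ) :* f :* i :- f :* (x :- n) :* i := f :* ((con 1ℚ :+ n) :* i)) ≈-refl
         x (ff x n) (fromℕᵣ n) i' ⟩
  ff x n * ((1ℝ + fromℕᵣ n) * i')
    ≈⟨ *-cong ≈-refl (≈-trans (*-cong (≈-sym (fromℕᵣ-suc n)) ≈-refl) (suc*1/suc! n)) ⟩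
  binom x n ∎
  where
  i' : ℝ
  i' = 1/ (suc n) !

-- Δᵐ takes binom(x,k) to binom(x,k - m), and to 0 once m > k, so every order n ≥ k gives the same
-- sum. With the powers of -½ as left factor, `⊛` unfolds exactly as `T` does.
T-binom : ∀ n {k} → k ℕ.≤ n → ∀ x → T n (λ y → binom y k) x ≈ ((ι -½ ^_) ⊛ binom x) k
T-binom zero    {zero}  _ x = solve 1 (λ b → b := con 1ℚ :* b :+ con 0ℚ) ≈-refl (binom x 0)
T-binom (suc n) {zero}  _ x = ≈-trans
  (+-cong ≈-refl (*-cong ≈-refl (T-zero n (λ _ → R.-‿inverseʳ _) x)))
  (solve 1 (λ b → b :+ con -½ :* con 0ℚ := con 1ℚ :* b :+ con 0ℚ) ≈-refl (binom x 0))
T-binom (suc n) {suc k} (s≤s k≤n) x = begin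
  binom x (suc k) + ι -½ * T n (Δ (λ y → binom y (suc k))) x
    ≈⟨ +-cong (≈-sym (R.*-identityˡ _)) (*-cong ≈-refl (≈-trans (T-cong n (Δ-binom-suc k) x) (T-binom n k≤n x))) ⟩
  1ℝ * binom x (suc k) + ι -½ * ((ι -½ ^_) ⊛ binom x) k
    ≈⟨ +-cong ≈-refl (·-⊛ (ι -½) (ι -½ ^_) (binom x) k) ⟨
  ((ι -½ ^_) ⊛ binom x) (suc k) ∎

T-ff : ∀ n {k} → k ℕ.≤ n → ∀ x → T n (λ y → ff y k) x ≈ fromℕᵣ (k !) * (Σ[ j ≤ k ] binom x j * ι -½ ^ (k ∸ j))
T-ff n {k} k≤n x = begin
  T n (λ y → ff y k) x                        ≈⟨ T-cong n (λ y → ≈-sym (n!*[z*1/n!] k (ff y k))) x ⟩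
  T n (λ y → fromℕᵣ (k !) * binom y k) x      ≈⟨ T-* n (fromℕᵣ (k !)) (λ y → binom y k) x ⟩
  fromℕᵣ (k !) * T n (λ y → binom y k) x      ≈⟨ *-cong ≈-refl (T-binom n k≤n x) ⟩
  -- Commutativity reverses the sum, so that its index becomes the lower entry of the binomial
  -- coefficient.
  fromℕᵣ (k !) * ((ι -½ ^_) ⊛ binom x) k      ≈⟨ *-cong ≈-refl (⊛-comm (ι -½ ^_) (binom x) k) ⟩
  fromℕᵣ (k !) * (binom x ⊛ (ι -½ ^_)) k      ∎

-- The operator applied to the two Stirling expansions

theorem4 : ∀ (lam x : ℝ) (n : ℕ) → lam ≉ 0ℝ →
    (S₁ S₂ : ℕ → ℕ → ℝ) → IsStirling₁ lam S₁ → IsStirling₂ lam S₂ →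
    ((Σ[ k ≤ n ] S₁ n k * 𝓔 lam k x)
    ≈ fromℕᵣ (n !) * (Σ[ k ≤ n ] binom x k * ι -½ ^ (n ∸ k)))
    × (𝓔 lam n x
    ≈ (Σ[ k ≤ n ] fromℕᵣ (k !) * S₂ n k * (Σ[ j ≤ k ] binom x j * ι -½ ^ (k ∸ j))))
theorem4 lam x n _ S₁ S₂ isS₁ isS₂ = first , second
  where
  B : ℕ → ℝ
  B k = Σ[ j ≤ k ] binom x j * ι -½ ^ (k ∸ j)

  first : (Σ[ k ≤ n ] S₁ n k * 𝓔 lam k x) ≈ fromℕᵣ (n !) * B n
  first = begin
    (Σ[ k ≤ n ] S₁ n k * 𝓔 lam k x)
      ≈⟨ Σ-cong≤ n (λ {k} k≤n → *-cong (≈-refl {S₁ n k}) (T-ff[] lam n k≤n x)) ⟨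
    (Σ[ k ≤ n ] S₁ n k * T n (λ y → ff[ lam ] y k) x)
      ≈⟨ T-Σ n n (S₁ n) (λ k y → ff[ lam ] y k) x ⟨
    T n (λ y → Σ[ k ≤ n ] S₁ n k * ff[ lam ] y k) x
      -- The Stirling identity enters as an identity of functions: `T n` evaluates at x, x + 1, ...,
      -- x + n.
      ≈⟨ T-cong n (isS₁ n) x ⟨
    T n (λ y → ff y n) x
      ≈⟨ T-ff n ℕ.≤-refl x ⟩
    fromℕᵣ (n !) * B n ∎

  second : 𝓔 lam n x ≈ (Σ[ k ≤ n ] fromℕᵣ (k !) * S₂ n k * B k)
  second = begin
    𝓔 lam n x
      ≈⟨ T-ff[] lam n ℕ.≤-refl x ⟨
    T n (λ y → ff[ lam ] y n) x
      ≈⟨ T-cong n (isS₂ n) x ⟩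
    T n (λ y → Σ[ k ≤ n ] S₂ n k * ff y k) x
      ≈⟨ T-Σ n n (S₂ n) (λ k y → ff y k) x ⟩
    (Σ[ k ≤ n ] S₂ n k * T n (λ y → ff y k) x)
      ≈⟨ Σ-cong≤ n (λ {k} k≤n → ≈-trans (*-cong (≈-refl {S₂ n k}) (T-ff n k≤n x))
           (solve 3 (λ s f b → s :* (f :* b) := f :* s :* b) ≈-refl (S₂ n k) (fromℕᵣ (k !)) (B k))) ⟩
    (Σ[ k ≤ n ] fromℕᵣ (k !) * S₂ n k * B k) ∎
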